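{- (1) Let $(A,\wedge,\vee,\to,\top,\mathsf p,\mathsf p^*,\mathsf q,\mathsf q^*)$ be a Brouwerian algebra with unary operators $\mathsf p,\mathsf q$ and their residuals $\mathsf p^*,\mathsf q^*$ such that $x\wedge\mathsf p\top\le\mathsf q x$ and $x\wedge\mathsf q\top\le\mathsf p x$ for all $x\in A$. If we define $x\cdot y=(\mathsf p x\wedge y)\vee(x\wedge\mathsf q y)$, $$x\backslash y=(\mathsf p x\to y)\wedge\mathsf q^*(x\to y)\quad\text{and}\quad x/y=\mathsf p^*(y\to x)\wedge(\mathsf q y\to x),$$ then $(A,\wedge,\vee,\to,\top,\cdot,\backslash,/)$ is a unary-determined residuated Brouwerian-magma, and the unary operations are recovered by $\mathsf p x=x\cdot\top$, $\mathsf p^*x=x/\top$, $\mathsf q x=\top\cdot x$ and $\mathsf q^*x=\top\backslash x$. (2) Let $(A,\wedge,\vee,\to,\top,\cdot,\backslash,/)$ be a unary-determined residuated Brouwerian-magma and define $\mathsf p x=x\cdot\top$, $\mathsf p^*x=x/\top$, $\mathsf q x=\top\cdot x$ and $\mathsf q^*x=\top\backslash x$. Then $(A,\wedge,\vee,\to,\top,\mathsf p,\mathsf p^*,\mathsf q,\mathsf q^*)$ is a Brouwerian algebra with unary operators $\mathsf p,\mathsf q$ and dual operators $\mathsf p^*,\mathsf q^*$ that satisfies $x\wedge\mathsf p\top\le\mathsf q x$ and $x\wedge\mathsf q\top\le\mathsf p x$ for all $x\in A$.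
   Context: A Brouwerian algebra $(A,\wedge,\vee,\to,\top)$ is a lattice with top element $\top$ such that $x\wedge y\le z\iff y\le x\to z$ for all $x,y,z$ (its lattice is then distributive). A unary operator on a lattice is a unary operation preserving binary joins; a unary dual operator is one preserving binary meets. A residual of a unary operation $\mathsf p$ is a unary operation $\mathsf p^*$ with $\mathsf p x\le y\iff x\le\mathsf p^*y$ for all $x,y$. A residuated $\ell$-magma $(A,\wedge,\vee,\cdot,\backslash,/)$ is a lattice with binary operations satisfying $x\cdot y\le z\iff y\le x\backslash z\iff x\le z/y$ for all $x,y,z$. A residuated Brouwerian-magma is a residuated $\ell$-magma expanded with $\to,\top$ such that $(A,\wedge,\vee,\to,\top)$ is a Brouwerian algebra. It is unary-determined if $x\cdot y=((x\cdot\top)\wedge y)\vee(x\wedge(\top\cdot y))$ for all $x,y$. -}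

module Defs where

open import Level using (_⊔_)
open import Algebra.Core using (Op₁; Op₂)
open import Algebra.Definitions using (Congruent₁)
open import Algebra.Morphism.Definitions using (Homomorphic₂)
open import Function.Bundles using (_⇔_)
open import Relation.Binary.Core using (Rel)
open import Relation.Binary.Definitions using (Maximum; Adjoint)
open import Relation.Binary.Lattice.Structures using (IsLattice)

-- Algebras are based on setoids, with the lattice presented by its order.  The
-- order carries no extra information: x ≤ y is equivalent to (x ∧ y) ≈ x.
module _ {a ℓ₁ ℓ₂} {A : Set a} (_≈_ : Rel A ℓ₁) (_≤_ : Rel A ℓ₂) where

  -- No congruence law is needed for _⇨_, nor for _∙_, _\\_ and _//_ below:
  -- residuation makes these operations monotone or antitone in each argument,
  -- hence compatible with _≈_.
  record IsBrouwerianAlgebra (_∧_ _∨_ _⇨_ : Op₂ A) (⊤ : A) : Set (a ⊔ ℓ₁ ⊔ ℓ₂) where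
    field
      isLattice : IsLattice _≈_ _≤_ _∨_ _∧_
      maximum   : Maximum _≤_ ⊤
      residual  : ∀ x y z → ((x ∧ y) ≤ z) ⇔ (y ≤ (x ⇨ z))

    open IsLattice isLattice public

  -- Congruence must be required here: preserving binary joins (or meets) up to
  -- _≈_ does not by itself make a function well defined on the setoid.
  record IsUnaryOperator (_∨_ : Op₂ A) (p : Op₁ A) : Set (a ⊔ ℓ₁) where
    field
      cong   : Congruent₁ _≈_ p
      ∨-homo : Homomorphic₂ A A _≈_ p _∨_ _∨_

  record IsUnaryDualOperator (_∧_ : Op₂ A) (p : Op₁ A) : Set (a ⊔ ℓ₁) where
    field
      cong   : Congruent₁ _≈_ p
      ∧-homo : Homomorphic₂ A A _≈_ p _∧_ _∧_

  IsResidual : (p p* : Op₁ A) → Set (a ⊔ ℓ₂)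
  IsResidual p p* = Adjoint _≤_ _≤_ p p*

  -- x \\ y is x\y and x // y is x/y.
  record IsResiduatedℓMagma (_∧_ _∨_ _∙_ _\\_ _//_ : Op₂ A) : Set (a ⊔ ℓ₁ ⊔ ℓ₂) where
    field
      isLattice : IsLattice _≈_ _≤_ _∨_ _∧_
      residualˡ : ∀ x y z → ((x ∙ y) ≤ z) ⇔ (y ≤ (x \\ z))
      residualʳ : ∀ x y z → ((x ∙ y) ≤ z) ⇔ (x ≤ (z // y))

    open IsLattice isLattice public

  record IsResiduatedBrouwerianMagma (_∧_ _∨_ _⇨_ : Op₂ A) (⊤ : A) (_∙_ _\\_ _//_ : Op₂ A)
                                     : Set (a ⊔ ℓ₁ ⊔ ℓ₂) where
    field
      isResiduatedℓMagma  : IsResiduatedℓMagma _∧_ _∨_ _∙_ _\\_ _//_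
      isBrouwerianAlgebra : IsBrouwerianAlgebra _∧_ _∨_ _⇨_ ⊤

  UnaryDetermined : (_∧_ _∨_ : Op₂ A) (⊤ : A) (_∙_ : Op₂ A) → Set (a ⊔ ℓ₁)
  UnaryDetermined _∧_ _∨_ ⊤ _∙_ =
    ∀ x y → (x ∙ y) ≈ (((x ∙ ⊤) ∧ y) ∨ (x ∧ (⊤ ∙ y)))

{-# OPTIONS --safe #-}
-- Part (1): x ∙ y ≤ z says p x ∧ y ≤ z and x ∧ q y ≤ z; transposing each
-- inequality across ∧, and then across p or q, bounds y by x \\ z or x by z // y.
-- The inequality x ∧ q ⊤ ≤ p x says that the second joinand of x ∙ ⊤ is
-- absorbed, so p x ≈ x ∙ ⊤, and p* is then recovered as the right adjoint of p
-- is unique; dually for q.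
--
-- Part (2): x ↦ x ∙ ⊤ and x ↦ ⊤ ∙ x have right adjoints by residuation, and left
-- adjoints preserve joins while right adjoints preserve meets.  The two
-- inequalities are unary-determinedness at ⊤ ∙ x and at x ∙ ⊤.
module Submission where

open import Defs
open import Algebra.Core using (Op₁; Op₂)
open import Data.Product.Base using (_×_; _,_; proj₁; proj₂; uncurry; <_,_>)
open import Data.Product.Function.NonDependent.Propositional using (_×-⇔_)
open import Function.Bundles using (_⇔_; mk⇔; Equivalence)
open import Function.Construct.Composition using (_⇔-∘_)
open import Relation.Binary.Core using (Rel; _Preserves_⟶_)
open import Relation.Binary.Lattice.Bundles using (Lattice)
open import Relation.Binary.Lattice.Structures using (IsLattice)
import Relation.Binary.Lattice.Properties.JoinSemilattice as JoinProperties
import Relation.Binary.Lattice.Properties.MeetSemilattice as MeetProperties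
import Relation.Binary.Properties.Poset as PosetProperties

open Equivalence using (to; from)

module LatticeProperties {a ℓ₁ ℓ₂} {A : Set a} {_≈_ : Rel A ℓ₁} {_≤_ : Rel A ℓ₂}
  {_∧_ _∨_ : Op₂ A} (isLattice : IsLattice _≈_ _≤_ _∨_ _∧_) where

  private
    lattice : Lattice a ℓ₁ ℓ₂
    lattice = record { isLattice = isLattice }

  open Lattice lattice public
    using (refl; reflexive; trans; antisym; module Eq; x≤x∨y; y≤x∨y; ∨-least;
           x∧y≤x; x∧y≤y; ∧-greatest; poset; joinSemilattice; meetSemilattice)
  open JoinProperties joinSemilattice public using (∨-cong)
  open MeetProperties meetSemilattice public using (∧-cong; ∧-comm)
  open PosetProperties poset public using (mono⇒cong)

  ∨≤⇔ : ∀ {x y z} → ((x ∨ y) ≤ z) ⇔ ((x ≤ z) × (y ≤ z))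
  ∨≤⇔ = mk⇔ < trans (x≤x∨y _ _) , trans (y≤x∨y _ _) > (uncurry ∨-least)

  -- Oriented from the pair to the meet, so that it can close a chain of equivalences that `∨≤⇔`
  -- opens.
  ≤∧⇔ : ∀ {x y z} → ((x ≤ y) × (x ≤ z)) ⇔ (x ≤ (y ∧ z))
  ≤∧⇔ = mk⇔ (uncurry ∧-greatest)
            (λ x≤y∧z → trans x≤y∧z (x∧y≤x _ _) , trans x≤y∧z (x∧y≤y _ _))

  ∧-comm-≤⇔ : ∀ {x y z} → ((x ∧ y) ≤ z) ⇔ ((y ∧ x) ≤ z)
  ∧-comm-≤⇔ = mk⇔ (trans (reflexive (∧-comm _ _))) (trans (reflexive (∧-comm _ _)))

  -- `p (p* x) ≤ x` holds by adjunction. Replacing `p` by `p′` and transposing along the other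
  -- adjunction gives `p* x ≤ p′* x`; the converse is symmetric.
  residual-unique : ∀ {p p′ p* p′* : Op₁ A} →
                    IsResidual _≈_ _≤_ p p* → IsResidual _≈_ _≤_ p′ p′* →
                    (∀ x → p x ≈ p′ x) → ∀ x → p* x ≈ p′* x
  residual-unique p⊣p* p′⊣p′* p≈p′ x = antisym
    (proj₁ p′⊣p′* (trans (reflexive (Eq.sym (p≈p′ _))) (proj₂ p⊣p* refl)))
    (proj₁ p⊣p* (trans (reflexive (p≈p′ _)) (proj₂ p′⊣p′* refl)))

  module _ {p p* : Op₁ A} (p⊣p* : IsResidual _≈_ _≤_ p p*) where

    residuated-monotone : p Preserves _≤_ ⟶ _≤_
    residuated-monotone x≤y = proj₂ p⊣p* (trans x≤y (proj₁ p⊣p* refl))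

    residual-monotone : p* Preserves _≤_ ⟶ _≤_
    residual-monotone x≤y = proj₁ p⊣p* (trans (proj₂ p⊣p* refl) x≤y)

    -- Congruence follows from monotonicity. The nontrivial half of join preservation transposes to
    -- `x ∨ y ≤ p* (p x ∨ p y)`, which is checked on each joinand.
    residuated⇒isUnaryOperator : IsUnaryOperator _≈_ _≤_ _∨_ p
    residuated⇒isUnaryOperator = record
      { cong   = mono⇒cong residuated-monotone
      ; ∨-homo = λ _ _ → antisym
          (proj₂ p⊣p* (∨-least (proj₁ p⊣p* (x≤x∨y _ _)) (proj₁ p⊣p* (y≤x∨y _ _))))
          (∨-least (residuated-monotone (x≤x∨y _ _)) (residuated-monotone (y≤x∨y _ _)))
      }

    residual⇒isUnaryDualOperator : IsUnaryDualOperator _≈_ _≤_ _∧_ p*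
    residual⇒isUnaryDualOperator = record
      { cong   = mono⇒cong residual-monotone
      ; ∧-homo = λ _ _ → antisym
          (∧-greatest (residual-monotone (x∧y≤x _ _)) (residual-monotone (x∧y≤y _ _)))
          (proj₁ p⊣p* (∧-greatest (proj₂ p⊣p* (x∧y≤x _ _)) (proj₂ p⊣p* (x∧y≤y _ _))))
      }

  module _ {_∙_ _\\_ _//_ : Op₂ A}
    (isMagma : IsResiduatedℓMagma _≈_ _≤_ _∧_ _∨_ _∙_ _\\_ _//_) where

    open IsResiduatedℓMagma isMagma using (residualˡ; residualʳ)

    \\-isResidual : ∀ x → IsResidual _≈_ _≤_ (x ∙_) (x \\_)
    \\-isResidual x = to (residualˡ _ _ _) , from (residualˡ _ _ _)

    -- Fixing one factor turns the binary law into an adjunction of unary maps, so that the facts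
    -- about residuals apply. At `⊤` it makes `_// ⊤` the residual of `_∙ ⊤`.
    //-isResidual : ∀ y → IsResidual _≈_ _≤_ (_∙ y) (_// y)
    //-isResidual y = to (residualʳ _ _ _) , from (residualʳ _ _ _)

module FromUnaryOperators {a ℓ₁ ℓ₂} {A : Set a} {_≈_ : Rel A ℓ₁} {_≤_ : Rel A ℓ₂}
  {_∧_ _∨_ _⇨_ : Op₂ A} {⊤ : A} {p p* q q* : Op₁ A}
  (isBrouwerianAlgebra : IsBrouwerianAlgebra _≈_ _≤_ _∧_ _∨_ _⇨_ ⊤)
  (p⊣p* : IsResidual _≈_ _≤_ p p*)
  (q⊣q* : IsResidual _≈_ _≤_ q q*)
  where

  open IsBrouwerianAlgebra isBrouwerianAlgebra using (isLattice; maximum; residual)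
  open LatticeProperties isLattice

  _∙_ _\\_ _//_ : Op₂ A
  x ∙ y  = (p x ∧ y) ∨ (x ∧ q y)
  x \\ y = (p x ⇨ y) ∧ q* (x ⇨ y)
  x // y = p* (y ⇨ x) ∧ (q y ⇨ x)

  isResiduatedℓMagma : IsResiduatedℓMagma _≈_ _≤_ _∧_ _∨_ _∙_ _\\_ _//_
  isResiduatedℓMagma = record
    { isLattice = isLattice
    -- The chain reads from right to left. In the second component `q y ≤ x ⇨ z` is transposed once
    -- more, to free `y` from `q`.
    ; residualˡ = λ x y z →
        ≤∧⇔ ⇔-∘ ((residual _ _ _ ×-⇔ (uncurry mk⇔ q⊣q* ⇔-∘ residual _ _ _)) ⇔-∘ ∨≤⇔)
    -- `residual` isolates the right-hand member of a meet, but here `x` occurs in the left-hand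
    -- one, so both meets are commuted first.
    ; residualʳ = λ x y z →
        ≤∧⇔ ⇔-∘ (((uncurry mk⇔ p⊣p* ⇔-∘ (residual _ _ _ ⇔-∘ ∧-comm-≤⇔))
                  ×-⇔ (residual _ _ _ ⇔-∘ ∧-comm-≤⇔)) ⇔-∘ ∨≤⇔)
    }

  isResiduatedBrouwerianMagma :
    IsResiduatedBrouwerianMagma _≈_ _≤_ _∧_ _∨_ _⇨_ ⊤ _∙_ _\\_ _//_
  isResiduatedBrouwerianMagma = record
    { isResiduatedℓMagma  = isResiduatedℓMagma
    ; isBrouwerianAlgebra = isBrouwerianAlgebra
    }

  module _ (x∧p⊤≤qx : ∀ x → (x ∧ p ⊤) ≤ q x) (x∧q⊤≤px : ∀ x → (x ∧ q ⊤) ≤ p x) where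

    p≈∙⊤ : ∀ x → p x ≈ (x ∙ ⊤)
    p≈∙⊤ x = antisym (trans (∧-greatest refl (maximum _)) (x≤x∨y _ _))
                     (∨-least (x∧y≤x _ _) (x∧q⊤≤px x))

    q≈⊤∙ : ∀ x → q x ≈ (⊤ ∙ x)
    q≈⊤∙ x = antisym (trans (∧-greatest (maximum _) refl) (y≤x∨y _ _))
                     (∨-least (to ∧-comm-≤⇔ (x∧p⊤≤qx x)) (x∧y≤y _ _))

    -- Rewriting `p x` as `x ∙ ⊤` and `q y` as `⊤ ∙ y` turns the definition of `x ∙ y` into the
    -- required identity.
    unaryDetermined : UnaryDetermined _≈_ _≤_ _∧_ _∨_ ⊤ _∙_
    unaryDetermined x y = ∨-cong (∧-cong (p≈∙⊤ x) Eq.refl) (∧-cong Eq.refl (q≈⊤∙ y))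

    p*≈//⊤ : ∀ x → p* x ≈ (x // ⊤)
    p*≈//⊤ = residual-unique p⊣p* (//-isResidual isResiduatedℓMagma ⊤) p≈∙⊤

    q*≈⊤\\ : ∀ x → q* x ≈ (⊤ \\ x)
    q*≈⊤\\ = residual-unique q⊣q* (\\-isResidual isResiduatedℓMagma ⊤) q≈⊤∙

theorem3p1 :
  ∀ {a ℓ₁ ℓ₂} {A : Set a} (_≈_ : Rel A ℓ₁) (_≤_ : Rel A ℓ₂)
    (_∧_ _∨_ _⇨_ : Op₂ A) (⊤ : A) →
  -- (1)
  ( (p p* q q* : Op₁ A) →
    IsBrouwerianAlgebra _≈_ _≤_ _∧_ _∨_ _⇨_ ⊤ →
    IsUnaryOperator _≈_ _≤_ _∨_ p →
    IsUnaryOperator _≈_ _≤_ _∨_ q →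
    IsResidual _≈_ _≤_ p p* →
    IsResidual _≈_ _≤_ q q* →
    (∀ x → (x ∧ p ⊤) ≤ q x) →
    (∀ x → (x ∧ q ⊤) ≤ p x) →
    let
      _∙_ : Op₂ A
      _∙_ = λ x y → (p x ∧ y) ∨ (x ∧ q y)
      _\\_ : Op₂ A
      _\\_ = λ x y → (p x ⇨ y) ∧ q* (x ⇨ y)
      _//_ : Op₂ A
      _//_ = λ x y → p* (y ⇨ x) ∧ (q y ⇨ x)
    in
      IsResiduatedBrouwerianMagma _≈_ _≤_ _∧_ _∨_ _⇨_ ⊤ _∙_ _\\_ _//_
    × UnaryDetermined _≈_ _≤_ _∧_ _∨_ ⊤ _∙_
    × (∀ x → p x ≈ (x ∙ ⊤))
    × (∀ x → p* x ≈ (x // ⊤))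
    × (∀ x → q x ≈ (⊤ ∙ x))
    × (∀ x → q* x ≈ (⊤ \\ x)) )
  ×
  -- (2)
  ( (_∙_ _\\_ _//_ : Op₂ A) →
    IsResiduatedBrouwerianMagma _≈_ _≤_ _∧_ _∨_ _⇨_ ⊤ _∙_ _\\_ _//_ →
    UnaryDetermined _≈_ _≤_ _∧_ _∨_ ⊤ _∙_ →
    let
      p : Op₁ A
      p = λ x → x ∙ ⊤
      p* : Op₁ A
      p* = λ x → x // ⊤
      q : Op₁ A
      q = λ x → ⊤ ∙ x
      q* : Op₁ A
      q* = λ x → ⊤ \\ x
    in
      IsBrouwerianAlgebra _≈_ _≤_ _∧_ _∨_ _⇨_ ⊤
    × IsUnaryOperator _≈_ _≤_ _∨_ p
    × IsUnaryOperator _≈_ _≤_ _∨_ q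
    × IsUnaryDualOperator _≈_ _≤_ _∧_ p*
    × IsUnaryDualOperator _≈_ _≤_ _∧_ q*
    × (∀ x → (x ∧ p ⊤) ≤ q x)
    × (∀ x → (x ∧ q ⊤) ≤ p x) )
theorem3p1 _≈_ _≤_ _∧_ _∨_ _⇨_ ⊤ =
    (λ p p* q q* isBrouwerianAlgebra _ _ p⊣p* q⊣q* x∧p⊤≤qx x∧q⊤≤px →
      let open FromUnaryOperators isBrouwerianAlgebra p⊣p* q⊣q* in
        isResiduatedBrouwerianMagma
      , unaryDetermined x∧p⊤≤qx x∧q⊤≤px
      , p≈∙⊤ x∧p⊤≤qx x∧q⊤≤px
      , p*≈//⊤ x∧p⊤≤qx x∧q⊤≤px
      , q≈⊤∙ x∧p⊤≤qx x∧q⊤≤px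
      , q*≈⊤\\ x∧p⊤≤qx x∧q⊤≤px)
  , (λ _∙_ _\\_ _//_ isMagma unaryDetermined →
      let open IsResiduatedBrouwerianMagma isMagma
          open LatticeProperties (IsResiduatedℓMagma.isLattice isResiduatedℓMagma)
      in
        isBrouwerianAlgebra
      , residuated⇒isUnaryOperator (//-isResidual isResiduatedℓMagma ⊤)
      , residuated⇒isUnaryOperator (\\-isResidual isResiduatedℓMagma ⊤)
      , residual⇒isUnaryDualOperator (//-isResidual isResiduatedℓMagma ⊤)
      , residual⇒isUnaryDualOperator (\\-isResidual isResiduatedℓMagma ⊤)
      -- The element `⊤ ∙ ⊤` is both `p ⊤` and `q ⊤`. Here it enters as `p ⊤`, in the first joinand
      -- `(⊤ ∙ ⊤) ∧ x` of `⊤ ∙ x`.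
      , (λ x → to ∧-comm-≤⇔ (trans (x≤x∨y _ _) (reflexive (Eq.sym (unaryDetermined ⊤ x)))))
      -- Now it enters as `q ⊤`, in the second joinand `x ∧ (⊤ ∙ ⊤)` of `x ∙ ⊤`.
      , (λ x → trans (y≤x∨y _ _) (reflexive (Eq.sym (unaryDetermined x ⊤)))))
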